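{- Let $\mathbf{M}$ be a Markov chain with $n$ states. Given an $\ell_1$ distance tester with time complexity $T(n,\epsilon,\delta)$ and gap $f$, and an oracle next_node for $\mathbf{M}$, there exists a test (taking parameters $t,\epsilon,\delta$) with time complexity $O(n\,t\cdot T(n,\epsilon,\delta/n))$ and the following behavior: if $\mathbf{M}$ is $(f(\epsilon)/2,t)$-mixing then $\Pr[\mathbf{M}\text{ is accepted}]>1-\delta$; if $\mathbf{M}$ is not $(\epsilon,t)$-mixing then $\Pr[\mathbf{M}\text{ is accepted}]<\delta$.
   Context: A Markov chain on $n$ states is represented by its $n\times n$ transition probability matrix $\mathbf{M}$. For a state $u$, $\mathbf{e}_u$ is the row vector with a one in position $u$ and zeros elsewhere, so $\mathbf{e}_u\mathbf{M}^t$ is the distribution of the endpoint of a $t$-step random walk started at $u$. $\|\mathbf{v}\|_1=\sum_i|v_i|$. The chain $\mathbf{M}$ is $(\epsilon,t)$-mixing if there exists a distribution $\mathbf{s}$ such that $\|\mathbf{e}_u\mathbf{M}^t-\mathbf{s}\|_1\le\epsilon$ for all states $u$. The oracle next_node, on input a state $u$, responds at unit cost with a state $v$ with probability $\mathbf{M}(u,v)$ (independently across calls). An $\ell_1$ distance tester with gap $f$ and time complexity $T(n,\epsilon,\delta)$ is a randomized algorithm which, given parameters $\epsilon,\delta$ and oracle (sample) access to two distributions over the same $n$-element set, runs in time $T(n,\epsilon,\delta)$ (each sample counted at unit cost) and decides with confidence $1-\delta$ whether their $\ell_1$ distance is at most $f(\epsilon)$ (in which case it accepts) or more than $\epsilon$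 (in which case it rejects). -}

module Defs where

open import Algebra.Bundles using (CommutativeRing)
open import Algebra.Structures using (IsCommutativeRing)
open import Data.Bool.Base using (Bool; true; false; if_then_else_)
import Data.Bool.Properties as Bool
open import Data.Empty using (⊥)
open import Data.Fin.Base using (Fin; toℕ; fromℕ<)
import Data.Fin.Properties as Fin
open import Data.List.Base using (List; []; _∷_)
open import Data.List.Membership.Propositional using (_∈_)
open import Data.List.Relation.Unary.All using (All; []; _∷_; lookup)
open import Data.Maybe.Base using (Maybe; just; nothing)
open import Data.Nat.Base as ℕ using (ℕ; zero; suc)
import Data.Nat.DivMod as ℕ
import Data.Nat.Properties as ℕ
open import Data.Product.Base using (∃-syntax)
open import Data.Unit.Base using (⊤)
open import Data.Vec.Functional using (Vector)
open import Level using (Level; _⊔_) renaming (suc to lsuc)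
open import Relation.Binary.Construct.Closure.ReflexiveTransitive
  using (Star; _◅_) renaming (ε to ∅)
open import Relation.Binary.Core using (Rel)
open import Relation.Binary.PropositionalEquality.Core using (_≡_; _≢_)
open import Relation.Binary.Structures using (IsDecTotalOrder)
open import Relation.Nullary.Decidable.Core using (does; yes; no)
import Algebra.Definitions.RawMonoid as RawMonoidDefs
import Algebra.Properties.CommutativeMonoid.Sum as Sum
import Relation.Binary.Construct.NonStrictToStrict as ToStrict

------------------------------------------------------------------------
-- Scalars

-- The standard library has no real numbers.  Probabilities and parameters
-- are taken in an arbitrary ordered field: ℝ, with its classically
-- decidable order, is an instance, and so is ℚ.

record OrderedField (c ℓ : Level) : Set (lsuc (c ⊔ ℓ)) where
  infix  4 _≤_
  infixl 6 _+_ _-_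
  infixl 7 _*_ _/_
  infix  8 -_
  infix  9 _⁻¹
  field
    Carrier           : Set c
    _≤_               : Rel Carrier ℓ
    _+_ _*_           : Carrier → Carrier → Carrier
    -_                : Carrier → Carrier
    0# 1#             : Carrier
    _⁻¹               : Carrier → Carrier
    isCommutativeRing : IsCommutativeRing _≡_ _+_ _*_ -_ 0# 1#
    isDecTotalOrder   : IsDecTotalOrder _≡_ _≤_
    0≢1               : 0# ≢ 1#
    -- 0# ⁻¹ is unconstrained.
    *-inverseʳ        : ∀ x → x ≢ 0# → x * x ⁻¹ ≡ 1#
    +-monoˡ-≤         : ∀ z {x y} → x ≤ y → x + z ≤ y + z
    *-nonNegative     : ∀ {x y} → 0# ≤ x → 0# ≤ y → 0# ≤ x * y

  commutativeRing : CommutativeRing c c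
  commutativeRing = record { isCommutativeRing = isCommutativeRing }

  open CommutativeRing commutativeRing public
    using (+-rawMonoid; +-commutativeMonoid)
  open IsDecTotalOrder isDecTotalOrder public using (_≟_; _≤?_)
  open ToStrict _≡_ _≤_ public using (_<_)
  open Sum +-commutativeMonoid public using (sum; sum-syntax)

  _-_ : Carrier → Carrier → Carrier
  x - y = x + (- y)

  _/_ : Carrier → Carrier → Carrier
  x / y = x * y ⁻¹

  fromℕ : ℕ → Carrier
  fromℕ n = n × 1#
    where open RawMonoidDefs +-rawMonoid using (_×_)

  ∣_∣ : Carrier → Carrier
  ∣ x ∣ = if does (0# ≤? x) then x else - x

------------------------------------------------------------------------
-- Randomized algorithms with oracles

-- Algorithms are programs of a call-by-value functional language with
-- recursion, unit-cost arithmetic on naturals and scalars, and random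
-- choice.  Oracles are abstract values of function type: no term denotes
-- one, so a program can only call the oracles it is given.  Elements of an
-- n-element set are represented by the numbers 0, …, n - 1.

infixr 6 _⇒_
infixr 7 _⊗_

data Ty : Set where
  unit bool nat real : Ty
  list               : Ty → Ty
  _⊗_ _⇒_            : Ty → Ty → Ty

Ctx : Set
Ctx = List Ty

data Prim : Ty → Ty → Set where
  boolean               : Bool → Prim unit bool
  natural               : ℕ → Prim unit nat
  add monus mul quo rem : Prim (nat ⊗ nat) nat
  leq                   : Prim (nat ⊗ nat) bool
  toReal                : Prim nat real
  addR mulR             : Prim (real ⊗ real) real
  negR invR             : Prim real real
  leqR                  : Prim (real ⊗ real) bool
  fst                   : ∀ {σ τ} → Prim (σ ⊗ τ) σ
  snd                   : ∀ {σ τ} → Prim (σ ⊗ τ) τ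
  nil                   : ∀ {τ} → Prim unit (list τ)
  cons                  : ∀ {τ} → Prim (τ ⊗ list τ) (list τ)
  null                  : ∀ {τ} → Prim (list τ) bool
  head                  : ∀ {τ} → Prim (list τ) τ
  tail                  : ∀ {τ} → Prim (list τ) (list τ)

infixl 7 _·_

data Tm (Γ : Ctx) : Ty → Set where
  var      : ∀ {τ} → τ ∈ Γ → Tm Γ τ
  -- In the body, index 0 is the argument and index 1 the function itself.
  fun      : ∀ {σ τ} → Tm (σ ∷ (σ ⇒ τ) ∷ Γ) τ → Tm Γ (σ ⇒ τ)
  _·_      : ∀ {σ τ} → Tm Γ (σ ⇒ τ) → Tm Γ σ → Tm Γ τ
  -- Reference to a top-level definition.
  global   : ∀ {τ} → Tm [] τ → Tm Γ τ
  ⟨⟩       : Tm Γ unit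
  ⟨_,_⟩    : ∀ {σ τ} → Tm Γ σ → Tm Γ τ → Tm Γ (σ ⊗ τ)
  prim     : ∀ {σ τ} → Prim σ τ → Tm Γ σ → Tm Γ τ
  cond     : ∀ {τ} → Tm Γ bool → Tm Γ τ → Tm Γ τ → Tm Γ τ
  -- random m is uniform on {0, …, m}.
  random   : Tm Γ nat → Tm Γ nat

Program : Ty → Set
Program τ = Tm [] τ

-- Inputs: n, ε, δ and oracles for the two distributions.
L1TesterTy : Ty
L1TesterTy = nat ⇒ real ⇒ real ⇒ (unit ⇒ nat) ⇒ (unit ⇒ nat) ⇒ bool

-- Inputs: n, t, ε, δ and the oracle next_node.
MixingTestTy : Ty
MixingTestTy = nat ⇒ nat ⇒ real ⇒ real ⇒ (nat ⇒ nat) ⇒ bool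

module Model {c ℓ : Level} (K : OrderedField c ℓ) where
  open OrderedField K

  ----------------------------------------------------------------------
  -- Distributions and Markov chains

  record IsDistribution {n : ℕ} (p : Vector Carrier n) : Set (c ⊔ ℓ) where
    field
      nonNegative : ∀ i → 0# ≤ p i
      sum≡1       : sum p ≡ 1#

  record Distribution (n : ℕ) : Set (c ⊔ ℓ) where
    field
      prob           : Vector Carrier n
      isDistribution : IsDistribution prob

  open Distribution public using (prob)

  Matrix : ℕ → Set c
  Matrix n = Fin n → Fin n → Carrier

  record MarkovChain (n : ℕ) : Set (c ⊔ ℓ) where
    field
      transition : Matrix n
      stochastic : ∀ u → IsDistribution (transition u)

  open MarkovChain public using (transition)

  𝐞 : ∀ {n} → Fin n → Vector Carrier n
  𝐞 u v = if does (u Fin.≟ v) then 1# else 0#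

  infixl 7 _ᵛ*_
  _ᵛ*_ : ∀ {n} → Vector Carrier n → Matrix n → Vector Carrier n
  _ᵛ*_ {n} x A j = ∑[ i < n ] (x i * A i j)

  infixr 8 _^_
  _^_ : ∀ {n} → Matrix n → ℕ → Matrix n
  (A ^ zero)  i = 𝐞 i
  (A ^ suc t) i = A i ᵛ* (A ^ t)

  ‖_‖₁ : ∀ {n} → Vector Carrier n → Carrier
  ‖_‖₁ {n} x = ∑[ i < n ] ∣ x i ∣

  infixl 6 _⊖_
  _⊖_ : ∀ {n} → Vector Carrier n → Vector Carrier n → Vector Carrier n
  (x ⊖ y) i = x i - y i

  Mixing : ∀ {n} → Carrier → ℕ → MarkovChain n → Set (c ⊔ ℓ)
  Mixing {n} η t M =
    ∃[ s ] ∀ (u : Fin n) → ‖ 𝐞 u ᵛ* (transition M ^ t) ⊖ prob {n} s ‖₁ ≤ η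

  ----------------------------------------------------------------------
  -- Semantics

  data Val : Ty → Set (c ⊔ ℓ) where
    unit      : Val unit
    bool      : Bool → Val bool
    nat       : ℕ → Val nat
    real      : Carrier → Val real
    nil       : ∀ {τ} → Val (list τ)
    cons      : ∀ {τ} → Val τ → Val (list τ) → Val (list τ)
    pair      : ∀ {σ τ} → Val σ → Val τ → Val (σ ⊗ τ)
    closure   : ∀ {Γ σ τ} → Tm (σ ∷ (σ ⇒ τ) ∷ Γ) τ → All Val Γ → Val (σ ⇒ τ)
    sampler   : ∀ {n} → Distribution n → Val (unit ⇒ nat)
    next-node : ∀ {n} → MarkovChain n → Val (nat ⇒ nat)

  Env : Ctx → Set (c ⊔ ℓ)
  Env = All Val

  evalPrim : ∀ {σ τ} → Prim σ τ → Val σ → Maybe (Val τ)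
  evalPrim (boolean b) unit                       = just (bool b)
  evalPrim (natural n) unit                       = just (nat n)
  evalPrim add    (pair (nat m) (nat n))          = just (nat (m ℕ.+ n))
  evalPrim monus  (pair (nat m) (nat n))          = just (nat (m ℕ.∸ n))
  evalPrim mul    (pair (nat m) (nat n))          = just (nat (m ℕ.* n))
  evalPrim quo    (pair (nat m) (nat zero))       = nothing
  evalPrim quo    (pair (nat m) (nat n@(suc _)))  = just (nat (m ℕ./ n))
  evalPrim rem    (pair (nat m) (nat zero))       = nothing
  evalPrim rem    (pair (nat m) (nat n@(suc _)))  = just (nat (m ℕ.% n))
  evalPrim leq    (pair (nat m) (nat n))          = just (bool (does (m ℕ.≤? n)))
  evalPrim toReal (nat n)                         = just (real (fromℕ n))
  evalPrim addR   (pair (real x) (real y))        = just (real (x + y))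
  evalPrim mulR   (pair (real x) (real y))        = just (real (x * y))
  evalPrim negR   (real x)                        = just (real (- x))
  evalPrim invR   (real x)                        =
    if does (x ≟ 0#) then nothing else just (real (x ⁻¹))
  evalPrim leqR   (pair (real x) (real y))        = just (bool (does (x ≤? y)))
  evalPrim fst    (pair v w)                      = just v
  evalPrim snd    (pair v w)                      = just w
  evalPrim nil    unit                            = just nil
  evalPrim cons   (pair v vs)                     = just (cons v vs)
  evalPrim null   nil                             = just (bool true)
  evalPrim null   (cons _ _)                      = just (bool false)
  evalPrim head   nil                             = nothing
  evalPrim head   (cons v vs)                     = just v
  evalPrim tail   nil                             = nothing
  evalPrim tail   (cons v vs)                     = just vs

  -- Abstract machine; a frame of type Frame σ τ awaits a value of type σ.
  -- The argument of an application is evaluated before the function.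
  data Frame : Ty → Ty → Set (c ⊔ ℓ) where
    argOf   : ∀ {Γ σ τ} → Tm Γ (σ ⇒ τ) → Env Γ → Frame σ τ
    applyTo : ∀ {σ τ} → Val σ → Frame (σ ⇒ τ) τ
    pairˡ   : ∀ {Γ σ τ} → Tm Γ τ → Env Γ → Frame σ (σ ⊗ τ)
    pairʳ   : ∀ {σ τ} → Val σ → Frame τ (σ ⊗ τ)
    prim    : ∀ {σ τ} → Prim σ τ → Frame σ τ
    cond    : ∀ {Γ τ} → Tm Γ τ → Tm Γ τ → Env Γ → Frame bool τ
    random  : Frame nat nat

  Stack : Ty → Ty → Set (c ⊔ ℓ)
  Stack = Star Frame

  data Config (υ : Ty) : Set (c ⊔ ℓ) where
    eval : ∀ {Γ τ} → Tm Γ τ → Env Γ → Stack τ υ → Config υ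
    ret  : ∀ {τ} → Val τ → Stack τ υ → Config υ

  data Transition (υ : Ty) : Set (c ⊔ ℓ) where
    halt  : Val υ → Transition υ
    goto  : Config υ → Transition υ
    draw  : ∀ {n} → Vector Carrier n → (Fin n → Config υ) → Transition υ
    stuck : Transition υ

  drawNat : ∀ {n υ} → Vector Carrier n → Stack nat υ → Transition υ
  drawNat p κ = draw p (λ i → ret (nat (toℕ i)) κ)

  apply : ∀ {σ τ υ} → Val (σ ⇒ τ) → Val σ → Stack τ υ → Transition υ
  apply f@(closure e ρ) v κ = goto (eval e (v ∷ f ∷ ρ) κ)
  apply (sampler P) unit κ  = drawNat (prob P) κ
  apply (next-node {n} M) (nat u) κ with u ℕ.<? n
  ... | yes u<n = drawNat (transition M (fromℕ< u<n)) κ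
  ... | no  _   = stuck

  resume : ∀ {σ τ υ} → Frame σ τ → Val σ → Stack τ υ → Transition υ
  resume (argOf f ρ)    v            κ = goto (eval f ρ (applyTo v ◅ κ))
  resume (applyTo v)    f            κ = apply f v κ
  resume (pairˡ e ρ)    v            κ = goto (eval e ρ (pairʳ v ◅ κ))
  resume (pairʳ v)      w            κ = goto (ret (pair v w) κ)
  resume (prim p)       v            κ with evalPrim p v
  ... | just w  = goto (ret w κ)
  ... | nothing = stuck
  resume (cond e₁ e₂ ρ) (bool true)  κ = goto (eval e₁ ρ κ)
  resume (cond e₁ e₂ ρ) (bool false) κ = goto (eval e₂ ρ κ)
  resume random         (nat m)      κ = drawNat {suc m} (λ _ → fromℕ (suc m) ⁻¹) κ

  step : ∀ {υ} → Config υ → Transition υ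
  step (eval (var x)       ρ κ) = goto (ret (lookup ρ x) κ)
  step (eval (fun e)       ρ κ) = goto (ret (closure e ρ) κ)
  step (eval (f · e)       ρ κ) = goto (eval e ρ (argOf f ρ ◅ κ))
  step (eval (global e)    ρ κ) = goto (eval e [] κ)
  step (eval ⟨⟩            ρ κ) = goto (ret unit κ)
  step (eval ⟨ e₁ , e₂ ⟩   ρ κ) = goto (eval e₁ ρ (pairˡ e₂ ρ ◅ κ))
  step (eval (prim p e)    ρ κ) = goto (eval e ρ (prim p ◅ κ))
  step (eval (cond b e₁ e₂) ρ κ) = goto (eval b ρ (cond e₁ e₂ ρ ◅ κ))
  step (eval (random e)    ρ κ) = goto (eval e ρ (random ◅ κ))
  step (ret v ∅)               = halt v
  step (ret v (φ ◅ κ))         = resume φ v κ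

  -- Running time is the number of transitions, oracle calls included, in
  -- the worst case over all outcomes of the draws.
  HaltsWithin  : ∀ {υ} → ℕ → Config υ → Set
  HaltsWithin′ : ∀ {υ} → ℕ → Transition υ → Set

  HaltsWithin zero    C = ⊥
  HaltsWithin (suc k) C = HaltsWithin′ k (step C)

  HaltsWithin′ k (halt v)   = ⊤
  HaltsWithin′ k (goto C)   = HaltsWithin k C
  HaltsWithin′ k (draw p C) = ∀ i → HaltsWithin k (C i)
  HaltsWithin′ k stuck      = ⊥

  -- Probability of halting with output b within the given number of
  -- transitions.
  Pr-output  : Bool → ℕ → Config bool → Carrier
  Pr-output′ : Bool → ℕ → Transition bool → Carrier

  Pr-output b zero    C = 0#
  Pr-output b (suc k) C = Pr-output′ b k (step C)

  Pr-output′ b k (halt (bool b′))  = if does (b Bool.≟ b′) then 1# else 0#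
  Pr-output′ b k (goto C)          = Pr-output b k C
  Pr-output′ b k (draw {n} p C)    = ∑[ i < n ] (p i * Pr-output b k (C i))
  Pr-output′ b k stuck             = 0#

  Pr-accept Pr-reject : ℕ → Config bool → Carrier
  Pr-accept = Pr-output true
  Pr-reject = Pr-output false

  ----------------------------------------------------------------------
  -- Testers

  runL1Tester : ∀ {n} → Program L1TesterTy → Carrier → Carrier →
                Distribution n → Distribution n → Config bool
  runL1Tester {n} A ε δ P Q =
    eval A [] (applyTo (nat n) ◅ applyTo (real ε) ◅ applyTo (real δ) ◅
               applyTo (sampler P) ◅ applyTo (sampler Q) ◅ ∅)

  record IsL1Tester (f : Carrier → Carrier) (T : ℕ → Carrier → Carrier → ℕ)
                    (A : Program L1TesterTy) : Set (c ⊔ ℓ) where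
    field
      halts   : ∀ {n} ε δ (P Q : Distribution n) → 0# < ε → 0# < δ → δ < 1# →
                HaltsWithin (T n ε δ) (runL1Tester A ε δ P Q)
      accepts : ∀ {n} ε δ (P Q : Distribution n) → 0# < ε → 0# < δ → δ < 1# →
                ‖ prob P ⊖ prob Q ‖₁ ≤ f ε →
                1# - δ ≤ Pr-accept (T n ε δ) (runL1Tester A ε δ P Q)
      rejects : ∀ {n} ε δ (P Q : Distribution n) → 0# < ε → 0# < δ → δ < 1# →
                ε < ‖ prob P ⊖ prob Q ‖₁ →
                1# - δ ≤ Pr-reject (T n ε δ) (runL1Tester A ε δ P Q)

  runMixingTest : ∀ {n} → Program MixingTestTy → ℕ → Carrier → Carrier →
                  MarkovChain n → Config bool
  runMixingTest {n} B t ε δ M =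
    eval B [] (applyTo (nat n) ◅ applyTo (nat t) ◅ applyTo (real ε) ◅
               applyTo (real δ) ◅ applyTo (next-node M) ◅ ∅)

{-# OPTIONS --safe #-}
module Submission where

-- Compare the endpoint distribution of a t-step walk from every state u ≠ 0 with
-- that from state 0, each time running the tester with confidence parameter
-- δ / n, and accept if all these n - 1 comparisons do.
--
-- If the chain is (f(ε)/2, t)-mixing, then any two endpoint distributions are
-- within f(ε) of each other by the triangle inequality (Mixing⇒close), so each
-- comparison passes with probability at least 1 - δ/n, and by the union bound all
-- pass with probability at least 1 - (n - 1) δ/n > 1 - δ.  If the chain is not
-- (ε, t)-mixing, then the endpoint distribution from state 0 fails to witness
-- mixing, so some u ≠ 0 is at distance more than ε from it (¬Mixing⇒far).  That
-- comparison passes with probability at most δ/n, which is less than δ because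
-- there are at least two states.  Using state 0 as the reference, rather than the
-- average over all states, saves one comparison and so gives strict inequalities.
--
-- The remaining work is about programs.  The tester is specified for oracles that
-- are samplers, but the test has to pass it procedures that walk along the chain.
-- A walk returns the right distribution after a number of transitions linear in
-- t (walk-samples-endpoint).  A logical relation between values that differ only
-- in their samplers shows that a tester run on such procedures accepts with the
-- same probability, and is slower by at most the cost of a walk per transition
-- (simulation).  Hence the loop accepts with the product of the probabilities of
-- the individual comparisons (loop-runs), within time O(n t T(n, ε, δ/n)).

open import Defs
open import Algebra.Bundles using (CommutativeRing)
import Algebra.Properties.AbelianGroup as AbelianGroupProperties
import Algebra.Properties.Ring as RingProperties
import Algebra.Properties.Semiring.Sum as SemiringSum
open import Data.Bool.Base using (true; false)
open import Data.Fin.Base as Fin using (Fin; zero; suc; toℕ; fromℕ<)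
import Data.Fin.Properties as Fin
open import Data.List.Base using ([]; _∷_)
open import Data.List.Membership.Propositional using (_∈_)
open import Data.List.Relation.Unary.All using ([]; _∷_; lookup)
open import Data.List.Relation.Unary.Any using (here; there)
open import Data.Maybe.Base using (just; nothing)
open import Data.Maybe.Relation.Binary.Pointwise using (Pointwise; just; nothing)
open import Data.Nat.Base as ℕ using (ℕ; zero; suc; NonZero)
open import Data.Nat.DivMod as ℕ using (_mod_)
import Data.Nat.Properties as ℕ
open import Data.Nat.Tactic.RingSolver using (solve-∀)
open import Data.Product.Base using (_×_; _,_; proj₁; proj₂; ∃-syntax; Σ-syntax)
open import Data.Sum.Base using (inj₁; inj₂; [_,_]′)
open import Data.Unit.Base using (⊤)
open import Data.Vec.Functional using (Vector)
open import Function.Base using (_∘_; id)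
open import Level using (Lift; _⊔_)
open import Relation.Binary.Bundles using (Poset)
import Relation.Binary.Construct.NonStrictToStrict as ToStrict
open import Relation.Binary.Construct.Closure.ReflexiveTransitive
  using (_◅_) renaming (ε to ∅)
open import Relation.Binary.PropositionalEquality
  using (_≡_; refl; sym; trans; cong; cong₂; subst; subst₂; module ≡-Reasoning)
import Relation.Binary.Reasoning.PartialOrder as PartialOrderReasoning
open import Relation.Binary.Structures using (IsDecTotalOrder)
open import Relation.Nullary.Decidable.Core using (does; yes; no)
open import Relation.Nullary.Negation.Core using (¬_; contradiction)

-- Ordered fields: inequalities, absolute values and finite products
module OrderedFieldProperties {c ℓ} (K : OrderedField c ℓ) where
  open OrderedField K
  open Model K using (‖_‖₁; _⊖_)
  open CommutativeRing commutativeRing public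
    using ( +-assoc; +-comm; +-identityˡ; +-identityʳ; -‿inverseˡ; -‿inverseʳ
          ; *-assoc; *-comm; *-identityˡ; *-identityʳ; distribˡ; distribʳ; zeroˡ; zeroʳ
          ; ring; semiring; +-abelianGroup)
  open IsDecTotalOrder isDecTotalOrder public
    using (isPartialOrder; total; antisym)
    renaming (refl to ≤-refl; trans to ≤-trans; reflexive to ≤-reflexive)
  open SemiringSum semiring public
    using (sum-cong-≗; ∑-comm; ∑-distrib-+; *-distribˡ-sum; *-distribʳ-sum; sum-replicate-zero)
  open RingProperties ring using (-‿distribʳ-*; -0#≈0#; -‿involutive)
  open AbelianGroupProperties +-abelianGroup using (⁻¹-anti-homo‿-)

  ≤-poset : Poset c c ℓ
  ≤-poset = record { isPartialOrder = isPartialOrder }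

  module ≤-Reasoning = PartialOrderReasoning ≤-poset

  ≤-<-trans : ∀ {x y z} → x ≤ y → y < z → x < z
  ≤-<-trans = ToStrict.≤-<-trans _≡_ _≤_ ≤-trans antisym (λ { refl → id })

  <-≤-trans : ∀ {x y z} → x < y → y ≤ z → x < z
  <-≤-trans = ToStrict.<-≤-trans _≡_ _≤_ sym ≤-trans antisym (λ { refl → id })

  ≰⇒> : ∀ {x y} → ¬ (x ≤ y) → y < x
  ≰⇒> = ToStrict.≰⇒> _≡_ _≤_ sym ≤-reflexive total

  +-monoʳ-≤ : ∀ z {x y} → x ≤ y → z + x ≤ z + y
  +-monoʳ-≤ z {x} {y} x≤y = subst₂ _≤_ (+-comm x z) (+-comm y z) (+-monoˡ-≤ z x≤y)

  +-mono-≤ : ∀ {x y u v} → x ≤ y → u ≤ v → x + u ≤ y + v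
  +-mono-≤ {y = y} {u} x≤y u≤v = ≤-trans (+-monoˡ-≤ u x≤y) (+-monoʳ-≤ y u≤v)

  x+y-y≡x : ∀ x y → x + y - y ≡ x
  x+y-y≡x x y = trans (+-assoc x y (- y)) (trans (cong (x +_) (-‿inverseʳ y)) (+-identityʳ x))

  x-y+y≡x : ∀ x y → x - y + y ≡ x
  x-y+y≡x x y = trans (+-assoc x (- y) y) (trans (cong (x +_) (-‿inverseˡ y)) (+-identityʳ x))

  x-y+[y-z]≡x-z : ∀ x y z → (x - y) + (y - z) ≡ x - z
  x-y+[y-z]≡x-z x y z = trans (sym (+-assoc (x - y) y (- z))) (cong (_- z) (x-y+y≡x x y))

  +-cancelʳ-≤ : ∀ z {x y} → x + z ≤ y + z → x ≤ y
  +-cancelʳ-≤ z {x} {y} = subst₂ _≤_ (x+y-y≡x x z) (x+y-y≡x y z) ∘ +-monoˡ-≤ (- z)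

  x-y≤z⇒x≤z+y : ∀ {x y z} → x - y ≤ z → x ≤ z + y
  x-y≤z⇒x≤z+y {x} {y} = subst (_≤ _) (x-y+y≡x x y) ∘ +-monoˡ-≤ y

  x<z+y⇒x-y<z : ∀ {x y z} → x < z + y → x - y < z
  x<z+y⇒x-y<z {x} {y} {z} (x≤z+y , x≢z+y) =
    subst (x - y ≤_) (x+y-y≡x z y) (+-monoˡ-≤ (- y) x≤z+y) ,
    λ x-y≡z → x≢z+y (trans (sym (x-y+y≡x x y)) (cong (_+ y) x-y≡z))

  x≤y⇒0≤y-x : ∀ {x y} → x ≤ y → 0# ≤ y - x
  x≤y⇒0≤y-x {x} = subst (_≤ _) (-‿inverseʳ x) ∘ +-monoˡ-≤ (- x)

  x≤0⇒0≤-x : ∀ {x} → x ≤ 0# → 0# ≤ - x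
  x≤0⇒0≤-x {x} = subst (0# ≤_) (+-identityˡ (- x)) ∘ x≤y⇒0≤y-x

  x≤x+y : ∀ x {y} → 0# ≤ y → x ≤ x + y
  x≤x+y x {y} = subst (_≤ x + y) (+-identityʳ x) ∘ +-monoʳ-≤ x

  +-nonNegative : ∀ {x y} → 0# ≤ x → 0# ≤ y → 0# ≤ x + y
  +-nonNegative {x} 0≤x 0≤y = ≤-trans 0≤x (x≤x+y x 0≤y)

  *-monoˡ-≤ : ∀ {z} → 0# ≤ z → ∀ {x y} → x ≤ y → z * x ≤ z * y
  *-monoˡ-≤ {z} 0≤z {x} {y} x≤y = let open ≤-Reasoning in begin
    z * x                ≤⟨ x≤x+y (z * x) (*-nonNegative 0≤z (x≤y⇒0≤y-x x≤y)) ⟩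
    z * x + z * (y - x)  ≡⟨ distribˡ z x (y - x) ⟨
    z * (x + (y - x))    ≡⟨ cong (z *_) (trans (+-comm x (y - x)) (x-y+y≡x y x)) ⟩
    z * y                ∎

  xy≤x : ∀ {x y} → 0# ≤ x → y ≤ 1# → x * y ≤ x
  xy≤x {x} {y} 0≤x y≤1 = subst (x * y ≤_) (*-identityʳ x) (*-monoˡ-≤ 0≤x y≤1)

  xy≤y : ∀ {x y} → 0# ≤ y → x ≤ 1# → x * y ≤ y
  xy≤y {x} {y} 0≤y x≤1 = subst (_≤ y) (*-comm y x) (xy≤x 0≤y x≤1)

  0≤1 : 0# ≤ 1#
  0≤1 = [ id , (λ 1≤0 → subst (0# ≤_) -1*-1≡1 (*-nonNegative (x≤0⇒0≤-x 1≤0) (x≤0⇒0≤-x 1≤0))) ]′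
          (total 0# 1#)
    where
    -1*-1≡1 : - 1# * - 1# ≡ 1#
    -1*-1≡1 = trans (sym (-‿distribʳ-* (- 1#) 1#))
             (trans (cong -_ (*-identityʳ (- 1#))) (-‿involutive 1#))

  ⁻¹-nonNegative : ∀ {x} → 0# < x → 0# ≤ x ⁻¹
  ⁻¹-nonNegative {x} (0≤x , 0≢x) with total 0# (x ⁻¹)
  ... | inj₁ 0≤x⁻¹ = 0≤x⁻¹
  ... | inj₂ x⁻¹≤0 = contradiction (antisym 0≤1 1≤0) 0≢1
    where
    1≤0 : 1# ≤ 0#
    1≤0 = subst₂ _≤_ (*-inverseʳ x (0≢x ∘ sym)) (zeroʳ x) (*-monoˡ-≤ 0≤x x⁻¹≤0)

  fromℕ-nonNegative : ∀ n → 0# ≤ fromℕ n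
  fromℕ-nonNegative zero    = ≤-refl
  fromℕ-nonNegative (suc n) = +-nonNegative 0≤1 (fromℕ-nonNegative n)

  fromℕ-positive : ∀ n .{{_ : NonZero n}} → 0# < fromℕ n
  fromℕ-positive (suc n) = <-≤-trans (0≤1 , 0≢1) (x≤x+y 1# (fromℕ-nonNegative n))

  fromℕ≢0 : ∀ n .{{_ : NonZero n}} → ¬ fromℕ n ≡ 0#
  fromℕ≢0 n = proj₂ (fromℕ-positive n) ∘ sym

  fromℕ-*-/ : ∀ n .{{_ : NonZero n}} x → fromℕ n * (x / fromℕ n) ≡ x
  fromℕ-*-/ n x = let open ≡-Reasoning in begin
    fromℕ n * (x * fromℕ n ⁻¹)  ≡⟨ cong (fromℕ n *_) (*-comm x _) ⟩
    fromℕ n * (fromℕ n ⁻¹ * x)  ≡⟨ *-assoc (fromℕ n) _ x ⟨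
    fromℕ n * fromℕ n ⁻¹ * x    ≡⟨ cong (_* x) (*-inverseʳ _ (fromℕ≢0 n)) ⟩
    1# * x                      ≡⟨ *-identityˡ x ⟩
    x                           ∎

  fromℕ-suc-* : ∀ n x → fromℕ (suc n) * x ≡ x + fromℕ n * x
  fromℕ-suc-* n x = trans (distribʳ x 1# (fromℕ n)) (cong (_+ fromℕ n * x) (*-identityˡ x))

  halves : ∀ x → x / fromℕ 2 + x / fromℕ 2 ≡ x
  halves x = trans (sym doubled) (fromℕ-*-/ 2 x)
    where
    y : Carrier
    y = x / fromℕ 2
    doubled : fromℕ 2 * y ≡ y + y
    doubled = trans (fromℕ-suc-* 1 y) (cong (y +_)
             (trans (fromℕ-suc-* 0 y) (trans (cong (y +_) (zeroˡ y)) (+-identityʳ y))))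

  share-positive : ∀ n .{{_ : NonZero n}} {x} → 0# < x → 0# < x / fromℕ n
  share-positive n {x} (0≤x , 0≢x) =
    *-nonNegative 0≤x (⁻¹-nonNegative (fromℕ-positive n)) ,
    λ 0≡x/n → 0≢x (trans (sym (zeroʳ (fromℕ n))) (trans (cong (fromℕ n *_) 0≡x/n) (fromℕ-*-/ n x)))

  -- One share is split off, since n shares out of 1 + n fall short of x by exactly
  -- that much: this is what makes the final inequalities strict.
  shares : ∀ n x → x / fromℕ (suc n) + fromℕ n * (x / fromℕ (suc n)) ≡ x
  shares n x = trans (sym (fromℕ-suc-* n (x / fromℕ (suc n)))) (fromℕ-*-/ (suc n) x)

  share-≤ : ∀ n .{{_ : NonZero n}} {x} → 0# < x → x / fromℕ n ≤ x
  share-≤ (suc n) {x} 0<x = subst (x / fromℕ (suc n) ≤_) (shares n x)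
    (x≤x+y _ (*-nonNegative (fromℕ-nonNegative n) (proj₁ (share-positive (suc n) 0<x))))

  x<x+y : ∀ x {y} → 0# < y → x < x + y
  x<x+y x {y} (0≤y , 0≢y) = x≤x+y x 0≤y , λ x≡x+y → 0≢y
    (let open ≡-Reasoning in begin
      0#         ≡⟨ -‿inverseʳ x ⟨
      x - x      ≡⟨ cong (_- x) (trans x≡x+y (+-comm x y)) ⟩
      y + x - x  ≡⟨ x+y-y≡x y x ⟩
      y          ∎)

  sum-mono-≤ : ∀ {n} {x y : Vector Carrier n} → (∀ i → x i ≤ y i) → sum x ≤ sum y
  sum-mono-≤ {zero}  x≤y = ≤-refl
  sum-mono-≤ {suc n} x≤y = +-mono-≤ (x≤y zero) (sum-mono-≤ (x≤y ∘ suc))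

  sum-nonNegative : ∀ {n} {x : Vector Carrier n} → (∀ i → 0# ≤ x i) → 0# ≤ sum x
  sum-nonNegative {zero}  0≤x = ≤-refl
  sum-nonNegative {suc n} 0≤x = +-nonNegative (0≤x zero) (sum-nonNegative (0≤x ∘ suc))

  -- The factors are numbered from 1, as are the states that the test compares
  -- with state 0.
  ∏ : (ℕ → Carrier) → ℕ → Carrier
  ∏ p zero    = 1#
  ∏ p (suc m) = p (suc m) * ∏ p m

  module _ {p : ℕ → Carrier} (0≤p : ∀ i → 0# ≤ p i) (p≤1 : ∀ i → p i ≤ 1#) where

    ∏-nonNegative : ∀ m → 0# ≤ ∏ p m
    ∏-nonNegative zero    = 0≤1
    ∏-nonNegative (suc m) = *-nonNegative (0≤p (suc m)) (∏-nonNegative m)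

    ∏≤1 : ∀ m → ∏ p m ≤ 1#
    ∏≤1 zero    = ≤-refl
    ∏≤1 (suc m) = ≤-trans (xy≤x (0≤p (suc m)) (∏≤1 m)) (p≤1 (suc m))

    ∏≤factor : ∀ {m i} → i ℕ.< m → ∏ p m ≤ p (suc i)
    ∏≤factor {suc m} {i} (ℕ.s≤s i≤m) with ℕ.m≤n⇒m<n∨m≡n i≤m
    ... | inj₂ refl = xy≤x (0≤p (suc m)) (∏≤1 m)
    ... | inj₁ i<m  = ≤-trans (xy≤y (∏-nonNegative m) (p≤1 (suc m))) (∏≤factor i<m)

    -- The union bound for independent events of probability p i, stated without
    -- subtraction: a factor x loses at most η, and multiplying the remaining loss
    -- m η by x ≤ 1 does not increase it.
    union-bound : ∀ {η} → 0# ≤ η → (∀ i → 1# ≤ p i + η) → ∀ m → 1# ≤ ∏ p m + fromℕ m * η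
    union-bound {η} 0≤η 1≤p+η zero    = ≤-reflexive
      (sym (trans (cong (1# +_) (zeroˡ η)) (+-identityʳ 1#)))
    union-bound {η} 0≤η 1≤p+η (suc m) = begin
      1#                              ≤⟨ 1≤p+η (suc m) ⟩
      x + η                           ≡⟨ cong (_+ η) (*-identityʳ x) ⟨
      x * 1# + η                      ≤⟨ +-monoˡ-≤ η (*-monoˡ-≤ (0≤p (suc m)) (union-bound 0≤η 1≤p+η m)) ⟩
      x * (∏ p m + fromℕ m * η) + η   ≡⟨ cong (_+ η) (distribˡ x _ _) ⟩
      x * ∏ p m + x * (fromℕ m * η) + η
        ≤⟨ +-monoˡ-≤ η (+-monoʳ-≤ _ (xy≤y (*-nonNegative (fromℕ-nonNegative m) 0≤η) (p≤1 (suc m)))) ⟩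
      x * ∏ p m + fromℕ m * η + η     ≡⟨ +-assoc _ _ η ⟩
      x * ∏ p m + (fromℕ m * η + η)   ≡⟨ cong (x * ∏ p m +_) (trans (+-comm _ η) (sym (fromℕ-suc-* m η))) ⟩
      x * ∏ p m + fromℕ (suc m) * η   ∎
      where
      open ≤-Reasoning
      x : Carrier
      x = p (suc m)

  x≤∣x∣ : ∀ x → x ≤ ∣ x ∣
  x≤∣x∣ x with 0# ≤? x
  ... | yes _   = ≤-refl
  ... | no  0≰x = ≤-trans x≤0 (x≤0⇒0≤-x x≤0)
    where x≤0 = proj₁ (≰⇒> 0≰x)

  -x≤∣x∣ : ∀ x → - x ≤ ∣ x ∣
  -x≤∣x∣ x with 0# ≤? x
  ... | no  _   = ≤-refl
  ... | yes 0≤x = ≤-trans (subst (_≤ 0#) (+-identityˡ (- x)) 0-x≤0) 0≤x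
    where
    0-x≤0 : 0# - x ≤ 0#
    0-x≤0 = subst (0# - x ≤_) (-‿inverseʳ x) (+-monoˡ-≤ (- x) 0≤x)

  ∣∣-least : ∀ {x y} → x ≤ y → - x ≤ y → ∣ x ∣ ≤ y
  ∣∣-least {x} x≤y -x≤y with 0# ≤? x
  ... | yes _ = x≤y
  ... | no  _ = -x≤y

  ∣x-y∣≤∣x-z∣+∣y-z∣ : ∀ x y z → ∣ x - y ∣ ≤ ∣ x - z ∣ + ∣ y - z ∣
  ∣x-y∣≤∣x-z∣+∣y-z∣ x y z = let open ≤-Reasoning in ∣∣-least
    (begin
      x - y                  ≡⟨ x-y+[y-z]≡x-z x z y ⟨
      (x - z) + (z - y)      ≡⟨ cong ((x - z) +_) (⁻¹-anti-homo‿- y z) ⟨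
      (x - z) + (- (y - z))  ≤⟨ +-mono-≤ (x≤∣x∣ (x - z)) (-x≤∣x∣ (y - z)) ⟩
      ∣ x - z ∣ + ∣ y - z ∣  ∎)
    (begin
      - (x - y)              ≡⟨ ⁻¹-anti-homo‿- x y ⟩
      y - x                  ≡⟨ x-y+[y-z]≡x-z y z x ⟨
      (y - z) + (z - x)      ≡⟨ cong ((y - z) +_) (⁻¹-anti-homo‿- x z) ⟨
      (y - z) + (- (x - z))  ≤⟨ +-mono-≤ (x≤∣x∣ (y - z)) (-x≤∣x∣ (x - z)) ⟩
      ∣ y - z ∣ + ∣ x - z ∣  ≡⟨ +-comm ∣ y - z ∣ ∣ x - z ∣ ⟩
      ∣ x - z ∣ + ∣ y - z ∣  ∎)

  -- The triangle inequality, with symmetry of the distance built in: both points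
  -- are compared with the same third one.
  ‖x⊖y‖≤‖x⊖z‖+‖y⊖z‖ : ∀ {n} (x y z : Vector Carrier n) →
                        ‖ x ⊖ y ‖₁ ≤ ‖ x ⊖ z ‖₁ + ‖ y ⊖ z ‖₁
  ‖x⊖y‖≤‖x⊖z‖+‖y⊖z‖ x y z = ≤-trans
    (sum-mono-≤ (λ i → ∣x-y∣≤∣x-z∣+∣y-z∣ (x i) (y i) (z i)))
    (≤-reflexive (∑-distrib-+ (λ i → ∣ x i - z i ∣) (λ i → ∣ y i - z i ∣)))

  ‖x⊖x‖≤0 : ∀ {n} (x : Vector Carrier n) → ‖ x ⊖ x ‖₁ ≤ 0#
  ‖x⊖x‖≤0 {n} x = ≤-trans
    (sum-mono-≤ (λ i → ∣∣-least (≤-reflexive (-‿inverseʳ (x i)))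
      (≤-reflexive (trans (cong -_ (-‿inverseʳ (x i))) -0#≈0#))))
    (≤-reflexive (sum-replicate-zero n))

-- Finite distributions as row vectors
module Distributions {c ℓ} (K : OrderedField c ℓ) where
  open OrderedField K
  open Model K
  open OrderedFieldProperties K
  open ≡-Reasoning

  infixl 7 _∙_
  -- The expectation of a under x.
  _∙_ : ∀ {n} → Vector Carrier n → Vector Carrier n → Carrier
  _∙_ {n} x a = ∑[ i < n ] (x i * a i)

  ∙-congʳ : ∀ {n} (x : Vector Carrier n) {a b} → (∀ i → a i ≡ b i) → x ∙ a ≡ x ∙ b
  ∙-congʳ x a≡b = sum-cong-≗ (λ i → cong (x i *_) (a≡b i))

  ∙-*ʳ : ∀ {n} (x a : Vector Carrier n) b → x ∙ (λ i → a i * b) ≡ x ∙ a * b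
  ∙-*ʳ x a b = trans (sum-cong-≗ (λ i → sym (*-assoc (x i) (a i) b)))
                     (sym (*-distribʳ-sum b (λ i → x i * a i)))

  ∙-+ʳ : ∀ {n} (x a b : Vector Carrier n) → x ∙ (λ i → a i + b i) ≡ x ∙ a + x ∙ b
  ∙-+ʳ x a b = trans (sum-cong-≗ (λ i → distribˡ (x i) (a i) (b i)))
                     (∑-distrib-+ (λ i → x i * a i) (λ i → x i * b i))

  ∙-1 : ∀ {n} (x : Vector Carrier n) → x ∙ (λ _ → 1#) ≡ sum x
  ∙-1 x = sum-cong-≗ (λ i → *-identityʳ (x i))

  -- Conditioning on the first step: drawing from x A amounts to drawing i from x
  -- and then drawing from row i of A.
  ᵛ*-∙ : ∀ {m} (x : Vector Carrier m) (A : Matrix m) (a : Vector Carrier m) →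
         (x ᵛ* A) ∙ a ≡ x ∙ (λ i → A i ∙ a)
  ᵛ*-∙ {m} x A a = begin
    ∑[ j < m ] ((∑[ i < m ] (x i * A i j)) * a j)
      ≡⟨ sum-cong-≗ (λ j → *-distribʳ-sum (a j) (λ i → x i * A i j)) ⟩
    ∑[ j < m ] ∑[ i < m ] (x i * A i j * a j)
      ≡⟨ ∑-comm (λ j i → x i * A i j * a j) ⟩
    ∑[ i < m ] ∑[ j < m ] (x i * A i j * a j)
      ≡⟨ sum-cong-≗ (λ i → sum-cong-≗ (λ j → *-assoc (x i) (A i j) (a j))) ⟩
    ∑[ i < m ] ∑[ j < m ] (x i * (A i j * a j))
      ≡⟨ sum-cong-≗ (λ i → *-distribˡ-sum (x i) (λ j → A i j * a j)) ⟨
    ∑[ i < m ] (x i * (∑[ j < m ] (A i j * a j)))  ∎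

  𝐞-∙ : ∀ {n} (u : Fin n) (a : Vector Carrier n) → 𝐞 u ∙ a ≡ a u
  𝐞-∙ {suc n} zero a = begin
    1# * a zero + ∑[ i < n ] (0# * a (suc i))
      ≡⟨ cong₂ _+_ (*-identityˡ (a zero)) (sum-cong-≗ (λ i → zeroˡ (a (suc i)))) ⟩
    a zero + ∑[ i < n ] 0#  ≡⟨ cong (a zero +_) (sum-replicate-zero n) ⟩
    a zero + 0#             ≡⟨ +-identityʳ (a zero) ⟩
    a zero                  ∎
  𝐞-∙ (suc u) a = begin
    0# * a zero + 𝐞 u ∙ (a ∘ suc)  ≡⟨ cong₂ _+_ (zeroˡ (a zero)) (𝐞-∙ u (a ∘ suc)) ⟩
    0# + a (suc u)                 ≡⟨ +-identityˡ (a (suc u)) ⟩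
    a (suc u)                      ∎

  𝐞-isDistribution : ∀ {n} (u : Fin n) → IsDistribution (𝐞 u)
  𝐞-isDistribution u = record
    { nonNegative = nonNegative
    ; sum≡1       = trans (sym (∙-1 (𝐞 u))) (𝐞-∙ u (λ _ → 1#))
    }
    where
    nonNegative : ∀ v → 0# ≤ 𝐞 u v
    nonNegative v with does (u Fin.≟ v)
    ... | true  = 0≤1
    ... | false = ≤-refl

  ᵛ*-isDistribution : ∀ {n} {x : Vector Carrier n} {A : Matrix n} → IsDistribution x →
                      (∀ u → IsDistribution (A u)) → IsDistribution (x ᵛ* A)
  ᵛ*-isDistribution {x = x} {A} X As = record
    { nonNegative = λ j → sum-nonNegative (λ i →
        *-nonNegative (X.nonNegative i) (IsDistribution.nonNegative (As i) j))
    ; sum≡1       = begin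
        sum (x ᵛ* A)                ≡⟨ ∙-1 (x ᵛ* A) ⟨
        (x ᵛ* A) ∙ (λ _ → 1#)       ≡⟨ ᵛ*-∙ x A (λ _ → 1#) ⟩
        x ∙ (λ i → A i ∙ λ _ → 1#)  ≡⟨ ∙-congʳ x (λ i → trans (∙-1 (A i)) (IsDistribution.sum≡1 (As i))) ⟩
        x ∙ (λ _ → 1#)              ≡⟨ trans (∙-1 x) X.sum≡1 ⟩
        1#                          ∎
    }
    where module X = IsDistribution X

  ^-isDistribution : ∀ {n} {A : Matrix n} → (∀ u → IsDistribution (A u)) →
                     ∀ t u → IsDistribution ((A ^ t) u)
  ^-isDistribution As zero    u = 𝐞-isDistribution u
  ^-isDistribution As (suc t) u = ᵛ*-isDistribution (As u) (^-isDistribution As t)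

  uniform-isDistribution : ∀ n .{{_ : NonZero n}} →
                           IsDistribution {n} (λ _ → fromℕ n ⁻¹)
  uniform-isDistribution n = record
    { nonNegative = λ _ → ⁻¹-nonNegative (fromℕ-positive n)
    ; sum≡1       = trans (sum-constant n) (*-inverseʳ (fromℕ n) (fromℕ≢0 n))
    }
    where
    sum-constant : ∀ m {x} → ∑[ i < m ] x ≡ fromℕ m * x
    sum-constant zero        = sym (zeroˡ _)
    sum-constant (suc m) {x} = trans (cong (x +_) (sum-constant m)) (sym (fromℕ-suc-* m x))

  endpoint : ∀ {n} → MarkovChain n → ℕ → Fin n → Distribution n
  endpoint M t u = record
    { prob           = 𝐞 u ᵛ* (transition M ^ t)
    ; isDistribution = ᵛ*-isDistribution (𝐞-isDistribution u)
                         (^-isDistribution (MarkovChain.stochastic M) t)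
    }

-- Running time together with acceptance probability
module Execution {c ℓ} (K : OrderedField c ℓ) where
  open OrderedField K
  open Model K
  open OrderedFieldProperties K
  open Distributions K

  -- Time and probability are proved in one go, because the acceptance probability
  -- within k transitions is stable in k only once halting within k is known.
  -- Stated for transitions, the predicate unfolds along every deterministic step,
  -- so that Agda executes the straight-line parts of a program by computation.
  Runs : ℕ → Transition bool → Carrier → Set c
  Runs k S a = HaltsWithin′ k S × Pr-output′ true k S ≡ a

  Runs-draw : ∀ k {n} (p : Vector Carrier n) (C : Fin n → Config bool) {a : Vector Carrier n} →
              (∀ i → Runs k (goto (C i)) (a i)) → Runs k (draw p C) (p ∙ a)
  Runs-draw k p C rs = (λ i → proj₁ (rs i)) , ∙-congʳ p (λ i → proj₂ (rs i))

  -- Extra time changes nothing, because every branch has already halted.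
  mutual
    Runs-weaken : ∀ {k k′} → k ℕ.≤ k′ → ∀ S {a} → Runs k S a → Runs k′ S a
    Runs-weaken k≤k′ (halt (bool b)) r          = r
    Runs-weaken k≤k′ (goto C)        r          = Runs-weaken-goto k≤k′ C r
    Runs-weaken {k′ = k′} k≤k′ (draw p C) (h , refl) =
      Runs-draw k′ p C (λ i → Runs-weaken-goto k≤k′ (C i) (h i , refl))

    Runs-weaken-goto : ∀ {k k′} → k ℕ.≤ k′ → ∀ C {a} → Runs k (goto C) a → Runs k′ (goto C) a
    Runs-weaken-goto (ℕ.s≤s k≤k′) C r = Runs-weaken k≤k′ (step C) r

  -- An arbitrary transition may draw from any vector; only those that the machine
  -- produces draw from distributions, and only for these is the probability
  -- of an output sure to lie between 0 and 1.
  Proper : ∀ {υ} → Transition υ → Set (c ⊔ ℓ)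
  Proper (draw p C) = IsDistribution p
  Proper _          = Lift _ ⊤

  step-proper : ∀ {υ} (C : Config υ) → Proper (step C)
  step-proper (eval (var x)        ρ κ) = _
  step-proper (eval (fun e)        ρ κ) = _
  step-proper (eval (f · e)        ρ κ) = _
  step-proper (eval (global e)     ρ κ) = _
  step-proper (eval ⟨⟩             ρ κ) = _
  step-proper (eval ⟨ e₁ , e₂ ⟩    ρ κ) = _
  step-proper (eval (prim p e)     ρ κ) = _
  step-proper (eval (cond b e₁ e₂) ρ κ) = _
  step-proper (eval (random e)     ρ κ) = _
  step-proper (ret v ∅)                 = _
  step-proper (ret v (φ ◅ κ))           = resume-proper φ v κ
    where
    apply-proper : ∀ {σ τ υ} (f : Val (σ ⇒ τ)) (v : Val σ) (κ : Stack τ υ) → Proper (apply f v κ)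
    apply-proper (closure e ρ)     v       κ = _
    apply-proper (sampler P)       unit    κ = Distribution.isDistribution P
    apply-proper (next-node {n} M) (nat u) κ with u ℕ.<? n
    ... | yes u<n = MarkovChain.stochastic M (fromℕ< u<n)
    ... | no  _   = _

    resume-proper : ∀ {σ τ υ} (φ : Frame σ τ) (v : Val σ) (κ : Stack τ υ) → Proper (resume φ v κ)
    resume-proper (argOf f ρ)    v            κ = _
    resume-proper (applyTo v)    f            κ = apply-proper f v κ
    resume-proper (pairˡ e ρ)    v            κ = _
    resume-proper (pairʳ v)      w            κ = _
    resume-proper (prim p)       v            κ with evalPrim p v
    ... | just w  = _
    ... | nothing = _
    resume-proper (cond e₁ e₂ ρ) (bool true)  κ = _
    resume-proper (cond e₁ e₂ ρ) (bool false) κ = _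
    resume-proper random         (nat m)      κ = uniform-isDistribution (suc m)

  mutual
    Pr-nonNegative : ∀ b k C → 0# ≤ Pr-output b k C
    Pr-nonNegative b zero    C = ≤-refl
    Pr-nonNegative b (suc k) C = Pr-nonNegative′ b k (step C) (step-proper C)

    Pr-nonNegative′ : ∀ b k S → Proper S → 0# ≤ Pr-output′ b k S
    Pr-nonNegative′ true  k (halt (bool true))  _ = 0≤1
    Pr-nonNegative′ true  k (halt (bool false)) _ = ≤-refl
    Pr-nonNegative′ false k (halt (bool true))  _ = ≤-refl
    Pr-nonNegative′ false k (halt (bool false)) _ = 0≤1
    Pr-nonNegative′ b     k (goto C)            _ = Pr-nonNegative b k C
    Pr-nonNegative′ b     k (draw p C)          P = sum-nonNegative (λ i →
      *-nonNegative (IsDistribution.nonNegative P i) (Pr-nonNegative b k (C i)))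
    Pr-nonNegative′ b     k stuck               _ = ≤-refl

  mutual
    Pr-total≤1 : ∀ k C → Pr-accept k C + Pr-reject k C ≤ 1#
    Pr-total≤1 zero    C = subst (_≤ 1#) (sym (+-identityʳ 0#)) 0≤1
    Pr-total≤1 (suc k) C = Pr-total≤1′ k (step C) (step-proper C)

    Pr-total≤1′ : ∀ k S → Proper S → Pr-output′ true k S + Pr-output′ false k S ≤ 1#
    Pr-total≤1′ k (halt (bool true))  _ = ≤-reflexive (+-identityʳ 1#)
    Pr-total≤1′ k (halt (bool false)) _ = ≤-reflexive (+-identityˡ 1#)
    Pr-total≤1′ k (goto C)            _ = Pr-total≤1 k C
    Pr-total≤1′ k (draw p C)          P = begin
      p ∙ acc + p ∙ rej          ≡⟨ ∙-+ʳ p acc rej ⟨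
      p ∙ (λ i → acc i + rej i)  ≤⟨ sum-mono-≤ (λ i → *-monoˡ-≤ (nonNegative i) (Pr-total≤1 k (C i))) ⟩
      p ∙ (λ _ → 1#)             ≡⟨ trans (∙-1 p) sum≡1 ⟩
      1#                         ∎
      where
      open ≤-Reasoning
      open IsDistribution P
      acc rej : Vector Carrier _
      acc i = Pr-accept k (C i)
      rej i = Pr-reject k (C i)
    Pr-total≤1′ k stuck               _ = subst (_≤ 1#) (sym (+-identityʳ 0#)) 0≤1

  Pr-accept≤1 : ∀ k C → Pr-accept k C ≤ 1#
  Pr-accept≤1 k C = ≤-trans (x≤x+y _ (Pr-nonNegative false k C)) (Pr-total≤1 k C)

-- Replacing oracles by procedures that sample
module Simulation {c ℓ} (K : OrderedField c ℓ) where
  open OrderedField K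
  open Model K
  open OrderedFieldProperties K
  open Distributions K
  open Execution K

  -- The procedure w takes at most d steps on every branch and then returns i with
  -- probability p i.  Quantifying over the continuation κ and its acceptance
  -- probabilities a makes this a specification in weakest-precondition style, so
  -- that it can be used at any point of a running program.
  Samples : ∀ {n} → ℕ → Val (unit ⇒ nat) → Vector Carrier n → Set (c ⊔ ℓ)
  Samples {n} d w p = ∀ (κ : Stack nat bool) j (a : Vector Carrier n) →
    (∀ i → Runs j (goto (ret (nat (toℕ i)) κ)) (a i)) →
    Runs (d ℕ.+ j) (apply w unit κ) (p ∙ a)

  module _ (d : ℕ) where
    infix 4 _≼_ _≼ᴱ_ _≼ᶠ_

    -- v ≼ w: the value w is v with each sampler, at any depth, replaced by a value
    -- that samples from the same distribution within d steps.  There is no case for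
    -- next-node: a tester is only given samplers, so none of its values contains one.
    data _≼_  : ∀ {τ} → Val τ → Val τ → Set (c ⊔ ℓ)
    data _≼ᴱ_ : ∀ {Γ} → Env Γ → Env Γ → Set (c ⊔ ℓ)

    data _≼_ where
      unit    : unit ≼ unit
      bool    : ∀ b → bool b ≼ bool b
      nat     : ∀ m → nat m ≼ nat m
      real    : ∀ x → real x ≼ real x
      nil     : ∀ {τ} → nil {τ} ≼ nil
      cons    : ∀ {τ} {v v′ : Val τ} {vs vs′} → v ≼ v′ → vs ≼ vs′ → cons v vs ≼ cons v′ vs′
      pair    : ∀ {σ τ} {v v′ : Val σ} {w w′ : Val τ} → v ≼ v′ → w ≼ w′ → pair v w ≼ pair v′ w′
      closure : ∀ {Γ σ τ} (e : Tm (σ ∷ (σ ⇒ τ) ∷ Γ) τ) {ρ ρ′} → ρ ≼ᴱ ρ′ → closure e ρ ≼ closure e ρ′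
      sampler : ∀ {n} {P : Distribution n} {w} → Samples d w (prob P) → sampler P ≼ w

    data _≼ᴱ_ where
      []  : [] ≼ᴱ []
      _∷_ : ∀ {τ Γ} {v v′ : Val τ} {ρ ρ′ : Env Γ} → v ≼ v′ → ρ ≼ᴱ ρ′ → v ∷ ρ ≼ᴱ v′ ∷ ρ′

    data _≼ᶠ_ : ∀ {σ τ} → Frame σ τ → Frame σ τ → Set (c ⊔ ℓ) where
      argOf   : ∀ {Γ σ τ} (f : Tm Γ (σ ⇒ τ)) {ρ ρ′} → ρ ≼ᴱ ρ′ → argOf f ρ ≼ᶠ argOf f ρ′
      applyTo : ∀ {σ τ} {v v′ : Val σ} → v ≼ v′ → applyTo {τ = τ} v ≼ᶠ applyTo v′
      pairˡ   : ∀ {Γ σ τ} (e : Tm Γ τ) {ρ ρ′} → ρ ≼ᴱ ρ′ → pairˡ {σ = σ} e ρ ≼ᶠ pairˡ e ρ′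
      pairʳ   : ∀ {σ τ} {v v′ : Val σ} → v ≼ v′ → pairʳ {τ = τ} v ≼ᶠ pairʳ v′
      prim    : ∀ {σ τ} (p : Prim σ τ) → prim p ≼ᶠ prim p
      cond    : ∀ {Γ τ} (e₁ e₂ : Tm Γ τ) {ρ ρ′} → ρ ≼ᴱ ρ′ → cond e₁ e₂ ρ ≼ᶠ cond e₁ e₂ ρ′
      random  : random ≼ᶠ random

    lookup-≼ : ∀ {Γ τ} {ρ ρ′ : Env Γ} → ρ ≼ᴱ ρ′ → (x : τ ∈ Γ) → lookup ρ x ≼ lookup ρ′ x
    lookup-≼ (v≼v′ ∷ _)  (here refl) = v≼v′
    lookup-≼ (_ ∷ ρ≼ρ′) (there x)   = lookup-≼ ρ≼ρ′ x

    evalPrim-≼ : ∀ {σ τ} (p : Prim σ τ) {v v′ : Val σ} → v ≼ v′ →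
                 Pointwise _≼_ (evalPrim p v) (evalPrim p v′)
    evalPrim-≼ (boolean b) unit                      = just (bool b)
    evalPrim-≼ (natural n) unit                      = just (nat n)
    evalPrim-≼ add    (pair (nat m) (nat n))         = just (nat _)
    evalPrim-≼ monus  (pair (nat m) (nat n))         = just (nat _)
    evalPrim-≼ mul    (pair (nat m) (nat n))         = just (nat _)
    evalPrim-≼ quo    (pair (nat m) (nat zero))      = nothing
    evalPrim-≼ quo    (pair (nat m) (nat (suc n)))   = just (nat _)
    evalPrim-≼ rem    (pair (nat m) (nat zero))      = nothing
    evalPrim-≼ rem    (pair (nat m) (nat (suc n)))   = just (nat _)
    evalPrim-≼ leq    (pair (nat m) (nat n))         = just (bool _)
    evalPrim-≼ toReal (nat n)                        = just (real _)
    evalPrim-≼ addR   (pair (real x) (real y))       = just (real _)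
    evalPrim-≼ mulR   (pair (real x) (real y))       = just (real _)
    evalPrim-≼ negR   (real x)                       = just (real _)
    evalPrim-≼ invR   (real x) with does (x ≟ 0#)
    ... | true                                       = nothing
    ... | false                                      = just (real _)
    evalPrim-≼ leqR   (pair (real x) (real y))       = just (bool _)
    evalPrim-≼ fst    (pair v w)                     = just v
    evalPrim-≼ snd    (pair v w)                     = just w
    evalPrim-≼ nil    unit                           = just nil
    evalPrim-≼ cons   (pair v vs)                    = just (cons v vs)
    evalPrim-≼ null   nil                            = just (bool true)
    evalPrim-≼ null   (cons _ _)                     = just (bool false)
    evalPrim-≼ head   nil                            = nothing
    evalPrim-≼ head   (cons v vs)                    = just v
    evalPrim-≼ tail   nil                            = nothing
    evalPrim-≼ tail   (cons v vs)                    = just vs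

    -- A tester in isolation runs on a stack that ends in ∅; as a subroutine it runs
    -- on top of the stack κ₀ of its caller.
    module _ (κ₀ : Stack bool bool) where
      infix 4 _≼ˢ_ _≼ᶜ_

      data _≼ˢ_ : ∀ {τ} → Stack τ bool → Stack τ bool → Set (c ⊔ ℓ) where
        ∅   : ∅ ≼ˢ κ₀
        _◅_ : ∀ {σ τ} {φ φ′ : Frame σ τ} {κ κ′} → φ ≼ᶠ φ′ → κ ≼ˢ κ′ → φ ◅ κ ≼ˢ φ′ ◅ κ′

      data _≼ᶜ_ : Config bool → Config bool → Set (c ⊔ ℓ) where
        eval : ∀ {Γ τ} (e : Tm Γ τ) {ρ ρ′ κ κ′} → ρ ≼ᴱ ρ′ → κ ≼ˢ κ′ → eval e ρ κ ≼ᶜ eval e ρ′ κ′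
        ret  : ∀ {τ} {v v′ : Val τ} {κ κ′} → v ≼ v′ → κ ≼ˢ κ′ → ret v κ ≼ᶜ ret v′ κ′

      module _ {j a} (onTrue  : Runs j (goto (ret (bool true)  κ₀)) a)
                     (onFalse : Runs j (goto (ret (bool false) κ₀)) 0#) where

        -- Each transition of the tester is paid for by 1 + d transitions: one of its
        -- own, and d in case it calls a sampler.  The last j are left to the caller.
        budget : ℕ → ℕ
        budget zero    = j
        budget (suc k) = suc (d ℕ.+ budget k)

        j≤budget : ∀ k → j ℕ.≤ budget k
        j≤budget zero    = ℕ.≤-refl
        j≤budget (suc k) = ℕ.m≤n⇒m≤1+n (ℕ.≤-trans (j≤budget k) (ℕ.m≤n+m (budget k) d))

        budget≡ : ∀ k → budget k ≡ k ℕ.* suc d ℕ.+ j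
        budget≡ zero    = refl
        budget≡ (suc k) = cong suc (trans (cong (d ℕ.+_) (budget≡ k)) (sym (ℕ.+-assoc d _ j)))

        simulate : ∀ k {C C′} → C ≼ᶜ C′ → HaltsWithin k C →
                   Runs (budget k) (goto C′) (Pr-accept k C * a)

        simulate-step : ∀ k {C C′} → C ≼ᶜ C′ → HaltsWithin′ k (step C) →
                        Runs (suc (d ℕ.+ budget k)) (goto C′) (Pr-output′ true k (step C) * a)

        simulate-resume : ∀ k {σ τ} {φ φ′ : Frame σ τ} {v v′ κ κ′} →
                          φ ≼ᶠ φ′ → v ≼ v′ → κ ≼ˢ κ′ → HaltsWithin′ k (resume φ v κ) →
                          Runs (d ℕ.+ budget k) (resume φ′ v′ κ′) (Pr-output′ true k (resume φ v κ) * a)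

        simulate-apply : ∀ k {σ τ} {f f′ : Val (σ ⇒ τ)} {v v′ κ κ′} →
                         f ≼ f′ → v ≼ v′ → κ ≼ˢ κ′ → HaltsWithin′ k (apply f v κ) →
                         Runs (d ℕ.+ budget k) (apply f′ v′ κ′) (Pr-output′ true k (apply f v κ) * a)

        simulate-goto : ∀ k {C C′} → C ≼ᶜ C′ → HaltsWithin k C →
                        Runs (d ℕ.+ budget k) (goto C′) (Pr-accept k C * a)

        simulate (suc k) = simulate-step k

        simulate-goto k C≼C′ h =
          Runs-weaken (ℕ.m≤n+m (budget k) d) (goto _) (simulate k C≼C′ h)

        simulate-step k (eval (var x) ρ κ)         = simulate-goto k (ret (lookup-≼ ρ x) κ)
        simulate-step k (eval (fun e) ρ κ)         = simulate-goto k (ret (closure e ρ) κ)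
        simulate-step k (eval (f · e) ρ κ)         = simulate-goto k (eval e ρ (argOf f ρ ◅ κ))
        simulate-step k (eval (global e) ρ κ)      = simulate-goto k (eval e [] κ)
        simulate-step k (eval ⟨⟩ ρ κ)              = simulate-goto k (ret unit κ)
        simulate-step k (eval ⟨ e₁ , e₂ ⟩ ρ κ)     = simulate-goto k (eval e₁ ρ (pairˡ e₂ ρ ◅ κ))
        simulate-step k (eval (prim p e) ρ κ)      = simulate-goto k (eval e ρ (prim p ◅ κ))
        simulate-step k (eval (cond e e₁ e₂) ρ κ)  = simulate-goto k (eval e ρ (cond e₁ e₂ ρ ◅ κ))
        simulate-step k (eval (random e) ρ κ)      = simulate-goto k (eval e ρ (random ◅ κ))
        simulate-step k (ret v (φ ◅ κ))            = simulate-resume k φ v κ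
        simulate-step k (ret (bool b) ∅)         h =
          Runs-weaken (j≤budget (suc k)) (goto (ret (bool b) κ₀)) (answer b)
          where
          answer : ∀ b → Runs j (goto (ret (bool b) κ₀)) (Pr-output′ true k (halt (bool b)) * a)
          answer true  = subst (Runs j _) (sym (*-identityˡ a)) onTrue
          answer false = subst (Runs j _) (sym (zeroˡ a)) onFalse

        simulate-resume k (argOf f ρ) v κ = simulate-goto k (eval f ρ (applyTo v ◅ κ))
        simulate-resume k (applyTo v) f κ = simulate-apply k f v κ
        simulate-resume k (pairˡ e ρ) v κ = simulate-goto k (eval e ρ (pairʳ v ◅ κ))
        simulate-resume k (pairʳ v) w κ   = simulate-goto k (ret (pair v w) κ)
        simulate-resume k {v = v} {v′} (prim p) v≼v′ κ
          with evalPrim p v | evalPrim p v′ | evalPrim-≼ p v≼v′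
        ... | just _  | just _  | just w  = simulate-goto k (ret w κ)
        ... | nothing | nothing | nothing = λ ()
        simulate-resume k (cond e₁ e₂ ρ) (bool true)  κ = simulate-goto k (eval e₁ ρ κ)
        simulate-resume k (cond e₁ e₂ ρ) (bool false) κ = simulate-goto k (eval e₂ ρ κ)
        simulate-resume k {κ = κ} {κ′} random (nat m) κ≼κ′ h =
          subst (Runs (d ℕ.+ budget k) (drawNat p κ′)) (∙-*ʳ p (λ i → Pr-accept k (ret (nat (toℕ i)) κ)) a)
            (Runs-draw (d ℕ.+ budget k) p (λ i → ret (nat (toℕ i)) κ′) (λ i →
              simulate-goto k (ret (nat _) κ≼κ′) (h i)))
          where
          p : Vector Carrier (suc m)
          p _ = fromℕ (suc m) ⁻¹

        simulate-apply k (closure e ρ) v κ = simulate-goto k (eval e (v ∷ closure e ρ ∷ ρ) κ)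
        simulate-apply k {κ = κ} {κ′} (sampler {P = P} {w} samples) unit κ≼κ′ h =
          subst (Runs (d ℕ.+ budget k) (apply w unit κ′)) (∙-*ʳ (prob P) (λ i → Pr-accept k (ret (nat (toℕ i)) κ)) a)
            (samples κ′ (budget k) _ (λ i → simulate k (ret (nat _) κ≼κ′) (h i)))

        -- The tester can only call its samplers, so replacing them changes neither its
        -- control flow nor the distribution of its output.  Acceptance by the caller
        -- requires acceptance by the tester and then by the continuation, which are
        -- independent; this yields the product.
        simulation : ∀ k {C C′} → C ≼ᶜ C′ → HaltsWithin k C →
                     Runs (k ℕ.* suc d ℕ.+ j) (goto C′) (Pr-accept k C * a)
        simulation k {C′ = C′} C≼C′ h =
          subst (λ b → Runs b (goto C′) _) (budget≡ k) (simulate k C≼C′ h)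

-- The mixing test
literal : ∀ {Γ} → ℕ → Tm Γ nat
literal m = prim (natural m) ⟨⟩

-- Each fun binds two variables: even indices refer to arguments, odd ones to the
-- functions themselves.
pattern #0 = here refl
pattern #1 = there #0
pattern #2 = there #1
pattern #4 = there (there #2)
pattern #5 = there #4
pattern #6 = there #5
pattern #8 = there (there #6)
pattern #10 = there (there #8)

zero? : ∀ {Γ} → Tm Γ nat → Tm Γ bool
zero? e = prim leq ⟨ e , literal 0 ⟩

predecessor : ∀ {Γ} → Tm Γ nat → Tm Γ nat
predecessor e = prim monus ⟨ e , literal 1 ⟩

-- The variables of walk below, innermost first, each argument followed by the
-- function that it belongs to.
WalkCtx : Ctx
WalkCtx = nat ∷ (nat ⇒ unit ⇒ nat) ∷ nat ∷ (nat ⇒ nat ⇒ unit ⇒ nat) ∷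
          (nat ⇒ nat) ∷ ((nat ⇒ nat) ⇒ nat ⇒ nat ⇒ unit ⇒ nat) ∷ []

walkBody : Tm (unit ∷ (unit ⇒ nat) ∷ WalkCtx) nat
walkBody = cond (zero? m) u (w · predecessor m · (next · u) · ⟨⟩)
  where
  u    = var #2
  m    = var #4
  w    = var #5
  next = var #6

-- walk next t u is a procedure that returns the endpoint of a t-step walk from
-- u.  The unit argument comes last, so that applying walk to three arguments
-- yields an oracle of the type that the tester expects.
walk : Program ((nat ⇒ nat) ⇒ nat ⇒ nat ⇒ unit ⇒ nat)
walk = fun (fun (fun (fun walkBody)))

-- The inputs of the test, innermost first.
LoopCtx : Ctx
LoopCtx = (nat ⇒ nat) ∷ ((nat ⇒ nat) ⇒ bool) ∷ real ∷ (real ⇒ (nat ⇒ nat) ⇒ bool) ∷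
          real ∷ (real ⇒ real ⇒ (nat ⇒ nat) ⇒ bool) ∷
          nat ∷ (nat ⇒ real ⇒ real ⇒ (nat ⇒ nat) ⇒ bool) ∷
          nat ∷ MixingTestTy ∷ []

module _ (tester : Program L1TesterTy) where

  againstZero : Tm (nat ∷ (nat ⇒ bool) ∷ LoopCtx) bool
  againstZero = global tester · n · ε · prim mulR ⟨ δ , prim invR (prim toReal n) ⟩ ·
                (global walk · next · t · m) · (global walk · next · t · literal 0)
    where
    m    = var #0
    next = var #2
    δ    = var #4
    ε    = var #6
    t    = var #8
    n    = var #10

  loopBody : Tm (nat ∷ (nat ⇒ bool) ∷ LoopCtx) bool
  loopBody = cond (zero? m) (prim (boolean true) ⟨⟩)
                  (cond againstZero (loop · predecessor m) (prim (boolean false) ⟨⟩))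
    where
    m    = var #0
    loop = var #1

  -- The loop counts down from n - 1.  State 0 is not compared with itself, which
  -- keeps the number of comparisons strictly below n.
  mixingTest : Program MixingTestTy
  mixingTest = fun (fun (fun (fun (fun (fun loopBody · predecessor (var #8))))))

-- Running time of the test

-- The literals in the cost functions bound the number of transitions that the
-- machine makes between two calls of other procedures.
walkCost : ℕ → ℕ
walkCost zero    = 12
walkCost (suc m) = 38 ℕ.+ walkCost m

loopCost : ℕ → ℕ → ℕ → ℕ
loopCost t τ zero    = 16
loopCost t τ (suc u) = 72 ℕ.+ (τ ℕ.* suc (walkCost t) ℕ.+ (14 ℕ.+ loopCost t τ u))

testCost : ℕ → ℕ → ℕ → ℕ
testCost n t τ = 23 ℕ.+ loopCost t τ (n ℕ.∸ 1)

walkCost-linear : ∀ t .{{_ : NonZero t}} → suc (walkCost t) ℕ.≤ 51 ℕ.* t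
walkCost-linear 1             = ℕ.≤-refl
walkCost-linear (suc (suc t)) = begin
  38 ℕ.+ suc (walkCost (suc t))  ≤⟨ ℕ.+-mono-≤ (ℕ.m≤m+n 38 13) (walkCost-linear (suc t)) ⟩
  51 ℕ.+ 51 ℕ.* suc t            ≡⟨ ℕ.*-suc 51 (suc t) ⟨
  51 ℕ.* suc (suc t)             ∎
  where open ℕ.≤-Reasoning

-- The product n t τ dominates every constant and every term that lacks one of
-- the factors, because all three factors are at least 1.  A round takes 86 = 72 + 14
-- transitions besides the tester, and each transition of the tester stands for
-- 13 + 38 t, which is at most 51 t; this gives 137 = 86 + 51.
testCost-bound : ∀ n t τ .{{_ : NonZero n}} .{{_ : NonZero t}} .{{_ : NonZero τ}} →
                 testCost n t τ ℕ.≤ 137 ℕ.* (n ℕ.* t ℕ.* τ)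
testCost-bound (suc u) t τ = begin
  23 ℕ.+ loopCost t τ u                    ≡⟨ cong (23 ℕ.+_) (loopCost-closed u) ⟩
  39 ℕ.+ u ℕ.* (86 ℕ.+ τ ℕ.* suc (walkCost t))
    ≤⟨ ℕ.+-mono-≤ (ℕ.≤-trans (ℕ.m≤m+n 39 98) (ℕ.m≤m*n 137 (t ℕ.* τ)))
                  (ℕ.*-monoʳ-≤ u iteration-bound) ⟩
  suc u ℕ.* (137 ℕ.* (t ℕ.* τ))            ≡⟨ rearrange (suc u) t τ ⟩
  137 ℕ.* (suc u ℕ.* t ℕ.* τ)              ∎
  where
  open ℕ.≤-Reasoning

  instance
    tτ≢0 : NonZero (t ℕ.* τ)
    tτ≢0 = ℕ.m*n≢0 t τ

  loopCost-closed : ∀ u → loopCost t τ u ≡ 16 ℕ.+ u ℕ.* (86 ℕ.+ τ ℕ.* suc (walkCost t))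
  loopCost-closed zero    = refl
  loopCost-closed (suc u) rewrite loopCost-closed u = collect (τ ℕ.* suc (walkCost t)) u
    where
    collect : ∀ x u → 72 ℕ.+ (x ℕ.+ (14 ℕ.+ (16 ℕ.+ u ℕ.* (86 ℕ.+ x)))) ≡ 16 ℕ.+ (1 ℕ.+ u) ℕ.* (86 ℕ.+ x)
    collect = solve-∀

  rearrange : ∀ n t τ → n ℕ.* (137 ℕ.* (t ℕ.* τ)) ≡ 137 ℕ.* (n ℕ.* t ℕ.* τ)
  rearrange = solve-∀

  iteration-bound : 86 ℕ.+ τ ℕ.* suc (walkCost t) ℕ.≤ 137 ℕ.* (t ℕ.* τ)
  iteration-bound = begin
    86 ℕ.+ τ ℕ.* suc (walkCost t)
      ≤⟨ ℕ.+-mono-≤ (ℕ.m≤m*n 86 (t ℕ.* τ)) (ℕ.*-monoʳ-≤ τ (walkCost-linear t)) ⟩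
    86 ℕ.* (t ℕ.* τ) ℕ.+ τ ℕ.* (51 ℕ.* t)  ≡⟨ gather t τ ⟩
    137 ℕ.* (t ℕ.* τ)                      ∎
    where
    gather : ∀ t τ → 86 ℕ.* (t ℕ.* τ) ℕ.+ τ ℕ.* (51 ℕ.* t) ≡ 137 ℕ.* (t ℕ.* τ)
    gather = solve-∀

-- Analysis of the random walk procedure
module Walk {c ℓ} (K : OrderedField c ℓ) where
  open OrderedField K
  open Model K
  open OrderedFieldProperties K
  open Distributions K
  open Execution K
  open Simulation K

  -- A walk only visits states of the chain, so next_node is never stuck.
  apply-next-node : ∀ {n υ} (M : MarkovChain n) u (κ : Stack nat υ) →
                    apply (next-node M) (nat (toℕ u)) κ ≡ drawNat (transition M u) κ
  apply-next-node {n} M u κ with toℕ u ℕ.<? n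
  ... | yes u<n = cong (λ i → drawNat (transition M i) κ) (Fin.fromℕ<-toℕ u u<n)
  ... | no  u≮n = contradiction (Fin.toℕ<n u) u≮n

  walkEnv : ∀ {n} → MarkovChain n → ℕ → ℕ → Env WalkCtx
  walkEnv M t u = nat u ∷ closure (fun walkBody) ρ₁ ∷ ρ₁
    where
    ρ₀ : Env _
    ρ₀ = next-node M ∷ closure (fun (fun (fun walkBody))) [] ∷ []
    ρ₁ : Env _
    ρ₁ = nat t ∷ closure (fun (fun walkBody)) ρ₀ ∷ ρ₀

  walkFrom : ∀ {n} → MarkovChain n → ℕ → ℕ → Val (unit ⇒ nat)
  walkFrom M t u = closure walkBody (walkEnv M t u)

  -- Induction on the length of the walk.  The recursion of the procedure matches
  -- that of the matrix power: first one step from u, then t steps from there.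
  walk-samples-row : ∀ {n} (M : MarkovChain n) t u →
                     Samples (walkCost t) (walkFrom M t (toℕ u)) ((transition M ^ t) u)
  walk-samples-row M zero    u κ j a rs =
    subst (Runs j (goto (ret (nat (toℕ u)) κ))) (sym (𝐞-∙ u a)) (rs u)
  walk-samples-row M (suc t) u κ j a rs =
    subst (λ S → Runs (18 ℕ.+ (walkCost t ℕ.+ j)) S ((transition M ^ suc t) u ∙ a))
          (sym (apply-next-node M u κ₁))
      (subst (Runs (18 ℕ.+ (walkCost t ℕ.+ j)) (drawNat (transition M u) κ₁))
             (sym (ᵛ*-∙ (transition M u) (transition M ^ t) a))
        (Runs-draw (18 ℕ.+ (walkCost t ℕ.+ j)) (transition M u) (λ v → ret (nat (toℕ v)) κ₁)
          (λ v → walk-samples-row M t v κ j a rs)))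
    where
    -- The stack at the call of next_node.  From its answer, 18 transitions lead to
    -- the start of the remaining walk.
    κ₁ : Stack nat bool
    κ₁ = argOf (var #5 · predecessor (var #4)) (unit ∷ walkFrom M (suc t) (toℕ u) ∷ walkEnv M (suc t) (toℕ u)) ◅
         applyTo unit ◅ κ

  walk-samples-endpoint : ∀ {n} (M : MarkovChain n) t u →
                          Samples (walkCost t) (walkFrom M t (toℕ u)) (prob (endpoint M t u))
  walk-samples-endpoint M t u κ j a rs =
    subst (Runs (walkCost t ℕ.+ j) (apply (walkFrom M t (toℕ u)) unit κ))
      (sym (trans (ᵛ*-∙ (𝐞 u) (transition M ^ t) a) (𝐞-∙ u (λ i → (transition M ^ t) i ∙ a))))
      (walk-samples-row M t u κ j a rs)

  -- The machine tests for zero before inverting; knowing x ≢ 0 resolves this test,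
  -- which an abstract field would leave undecided.
  apply-invR : ∀ {x υ} → ¬ x ≡ 0# → (κ : Stack real υ) →
               resume (prim invR) (real x) κ ≡ goto (ret (real (x ⁻¹)) κ)
  apply-invR {x} x≢0 κ with x ≟ 0#
  ... | yes x≡0 = contradiction x≡0 x≢0
  ... | no  _   = refl

-- Analysis of the loop over the states
module Loop {c ℓ} (K : OrderedField c ℓ) (tester : Program L1TesterTy) {n′ : ℕ}
            (M : Model.MarkovChain K (suc n′)) (t : ℕ)
            (ε δ : OrderedField.Carrier K) where
  open OrderedField K
  open Model K
  open OrderedFieldProperties K
  open Distributions K
  open Execution K
  open Simulation K
  open Walk K

  n : ℕ
  n = suc n′

  -- The loop runs over natural numbers; u mod n is the state numbered u whenever
  -- u < n, and makes the definition total.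
  comparison : ℕ → Config bool
  comparison u = runL1Tester tester ε (δ / fromℕ n) (endpoint M t (u mod n)) (endpoint M t zero)

  acceptsAll : ℕ → ℕ → Carrier
  acceptsAll τ = ∏ (λ u → Pr-accept τ (comparison u))

  loopEnv : Env LoopCtx
  loopEnv = next-node M ∷ closure e₅ ρ₄ ∷ ρ₄
    where
    e₅ = fun (loopBody tester) · predecessor (var #8)
    ρ₁ : Env _
    ρ₁ = nat n ∷ closure (fun (fun (fun (fun e₅)))) [] ∷ []
    ρ₂ : Env _
    ρ₂ = nat t ∷ closure (fun (fun (fun e₅))) ρ₁ ∷ ρ₁
    ρ₃ : Env _
    ρ₃ = real ε ∷ closure (fun (fun e₅)) ρ₂ ∷ ρ₂
    ρ₄ : Env _
    ρ₄ = real δ ∷ closure (fun e₅) ρ₃ ∷ ρ₃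

  loop : Val (nat ⇒ bool)
  loop = closure (loopBody tester) loopEnv

  iterationEnv : ℕ → Env (nat ∷ (nat ⇒ bool) ∷ LoopCtx)
  iterationEnv u = nat u ∷ loop ∷ loopEnv

  -- One round draws no randomness of its own: it reaches the tester by computation
  -- alone, up to the division by n.  The simulation handles the call, and its
  -- continuation is either the next round or immediate rejection.
  loop-runs : ∀ τ → (∀ u → HaltsWithin τ (comparison u)) → ∀ u → u ℕ.≤ n′ →
              Runs (loopCost t τ u) (apply loop (nat u) ∅) (acceptsAll τ u)
  loop-runs τ h zero    _    = _ , refl
  loop-runs τ h (suc u) u<n′ =
    subst (λ S → Runs K₁ S (acceptsAll τ (suc u))) (sym (apply-invR (fromℕ≢0 n) κ₂))
      (simulation (walkCost t) κ₀ onTrue (_ , refl) τ related (h (suc u)))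
    where
    -- The time left once n has been inverted, 10 transitions before the tester runs.
    K₁ : ℕ
    K₁ = 10 ℕ.+ (τ ℕ.* suc (walkCost t) ℕ.+ (14 ℕ.+ loopCost t τ u))
    -- What remains to be done with the answer of the tester.
    κ₀ : Stack bool bool
    κ₀ = cond (var #1 · predecessor (var #0)) (prim (boolean false) ⟨⟩) (iterationEnv (suc u)) ◅ ∅
    κ₁ : Stack (nat ⇒ real ⇒ real ⇒ (unit ⇒ nat) ⇒ (unit ⇒ nat) ⇒ bool) bool
    κ₁ = applyTo (nat n) ◅ applyTo (real ε) ◅ applyTo (real (δ / fromℕ n)) ◅
         applyTo (walkFrom M t (suc u)) ◅ applyTo (walkFrom M t 0) ◅ κ₀
    -- The stack at the inversion of n; the two walks, being evaluated before the
    -- error parameter, are already on it.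
    κ₂ : Stack real bool
    κ₂ = pairʳ (real δ) ◅ prim mulR ◅
         argOf (global tester · var #10 · var #6) (iterationEnv (suc u)) ◅
         applyTo (walkFrom M t (suc u)) ◅ applyTo (walkFrom M t 0) ◅ κ₀
    onTrue : Runs (14 ℕ.+ loopCost t τ u) (goto (ret (bool true) κ₀)) (acceptsAll τ u)
    onTrue = loop-runs τ h u (ℕ.<⇒≤ u<n′)
    related : _≼ᶜ_ (walkCost t) κ₀ (comparison (suc u)) (eval tester [] κ₁)
    related = eval tester [] (applyTo (nat n) ◅ applyTo (real ε) ◅ applyTo (real _) ◅
      applyTo (sampler samples) ◅ applyTo (sampler (walk-samples-endpoint M t zero)) ◅ ∅)
      where
      state : Fin n
      state = suc u mod n
      samples : Samples (walkCost t) (walkFrom M t (suc u)) (prob (endpoint M t state))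
      samples = subst (λ i → Samples (walkCost t) (walkFrom M t i) (prob (endpoint M t state)))
        (trans (Fin.toℕ-fromℕ< (ℕ.m%n<n (suc u) n)) (ℕ.m<n⇒m%n≡m (ℕ.s<s u<n′)))
        (walk-samples-endpoint M t state)

  test-runs : ∀ τ → (∀ u → HaltsWithin τ (comparison u)) →
              Runs (testCost n t τ) (goto (runMixingTest (mixingTest tester) t ε δ M)) (acceptsAll τ n′)
  test-runs τ h = loop-runs τ h n′ ℕ.≤-refl

-- Mixing and the errors of the tester
module Correctness {c ℓ} (K : OrderedField c ℓ) where
  open OrderedField K
  open Model K
  open OrderedFieldProperties K
  open Distributions K
  open Execution K

  -- The triangle inequality through the distribution s that witnesses mixing.
  Mixing⇒close : ∀ {n η} (M : MarkovChain n) t → Mixing η t M → ∀ u v →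
                 ‖ prob (endpoint M t u) ⊖ prob (endpoint M t v) ‖₁ ≤ η + η
  Mixing⇒close M t (s , near) u v = ≤-trans
    (‖x⊖y‖≤‖x⊖z‖+‖y⊖z‖ (prob (endpoint M t u)) (prob (endpoint M t v)) (prob s))
    (+-mono-≤ (near u) (near v))

  -- The endpoint distribution from state 0 is itself a candidate for s, so some
  -- state must be far from it.  Distances are decidably comparable and states are
  -- finite, so such a state can be found; it is not state 0.
  ¬Mixing⇒far : ∀ {n′ ε} (M : MarkovChain (suc n′)) t → 0# ≤ ε → ¬ Mixing ε t M →
                ∃[ i ] ε < ‖ prob (endpoint M t (suc i)) ⊖ prob (endpoint M t zero) ‖₁
  ¬Mixing⇒far {ε = ε} M t 0≤ε ¬mixing
    with Fin.¬∀⟶∃¬ _ _ (λ u → distance u ≤? ε) (λ near → ¬mixing (endpoint M t zero , near))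
    where
    distance : Fin _ → Carrier
    distance u = ‖ prob (endpoint M t u) ⊖ prob (endpoint M t zero) ‖₁
  ... | zero  , far = contradiction (≤-trans (‖x⊖x‖≤0 (prob (endpoint M t zero))) 0≤ε) far
  ... | suc i , far = i , ≰⇒> far

  module _ {f : Carrier → Carrier} {T : ℕ → Carrier → Carrier → ℕ}
           {tester : Program L1TesterTy} (isTester : IsL1Tester f T tester)
           where
    open IsL1Tester isTester

    -- Halting takes at least one transition.  Running the tester needs some
    -- distribution, and a point mass will do.
    T-nonZero : ∀ n .{{_ : NonZero n}} {ε δ} → 0# < ε → 0# < δ → δ < 1# → NonZero (T n ε δ)
    T-nonZero (suc n) {ε} {δ} 0<ε 0<δ δ<1 with T (suc n) ε δ | halts ε δ point point 0<ε 0<δ δ<1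
      where
      point : Distribution (suc n)
      point = record { prob = 𝐞 zero ; isDistribution = 𝐞-isDistribution zero }
    ... | suc _ | _ = _

    module _ {n′ : ℕ} (M : MarkovChain (suc n′)) (t : ℕ) {ε δ : Carrier}
             (0<ε : 0# < ε) (0<δ : 0# < δ) (δ<1 : δ < 1#) where
      open Loop K tester M t ε δ

      η : Carrier
      η = δ / fromℕ n

      0<η : 0# < η
      0<η = share-positive n 0<δ

      η<1 : η < 1#
      η<1 = ≤-<-trans (share-≤ n 0<δ) δ<1

      τ : ℕ
      τ = T n ε η

      pass : ℕ → Carrier
      pass u = Pr-accept τ (comparison u)

      0≤pass : ∀ u → 0# ≤ pass u
      0≤pass u = Pr-nonNegative true τ (comparison u)

      pass≤1 : ∀ u → pass u ≤ 1#
      pass≤1 u = Pr-accept≤1 τ (comparison u)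

      runs : Runs (testCost n t τ) (goto (runMixingTest (mixingTest tester) t ε δ M)) (acceptsAll τ n′)
      runs = test-runs τ (λ u → halts ε η (endpoint M t (u mod n)) (endpoint M t zero) 0<ε 0<η η<1)

      -- The n - 1 comparisons fail with total probability at most n - 1 shares δ / n,
      -- which is less than δ.
      acceptance : Mixing (f ε / fromℕ 2) t M → 1# - δ < acceptsAll τ n′
      acceptance mixing = x<z+y⇒x-y<z (≤-<-trans
        (union-bound 0≤pass pass≤1 (proj₁ 0<η) 1≤pass+η n′) ∏+n′η<∏+δ)
        where
        1≤pass+η : ∀ u → 1# ≤ pass u + η
        1≤pass+η u = x-y≤z⇒x≤z+y (accepts ε η (endpoint M t (u mod n)) (endpoint M t zero) 0<ε 0<η η<1
          (subst (‖ prob (endpoint M t (u mod n)) ⊖ prob (endpoint M t zero) ‖₁ ≤_) (halves (f ε))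
            (Mixing⇒close M t mixing (u mod n) zero)))

        ∏+n′η<∏+δ : acceptsAll τ n′ + fromℕ n′ * η < acceptsAll τ n′ + δ
        ∏+n′η<∏+δ = subst (acceptsAll τ n′ + fromℕ n′ * η <_)
          (trans (+-assoc _ _ η) (cong (acceptsAll τ n′ +_) (trans (+-comm _ η) (shares n′ δ))))
          (x<x+y (acceptsAll τ n′ + fromℕ n′ * η) 0<η)

      -- A single far state suffices: the test accepts with at most the probability
      -- that this one comparison passes, at most δ / n.  A far state other than 0
      -- exists only if n ≥ 2, so δ / n < δ.
      rejection : ¬ Mixing ε t M → acceptsAll τ n′ < δ
      rejection ¬mixing with ¬Mixing⇒far M t (proj₁ 0<ε) ¬mixing
      ... | i , far = ≤-<-trans (∏≤factor {p = pass} 0≤pass pass≤1 (Fin.toℕ<n i))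
                        (≤-<-trans pass≤η (η<δ i))
        where
        u : ℕ
        u = suc (toℕ i)

        u-mod-n≡i : u mod n ≡ suc i
        u-mod-n≡i = Fin.toℕ-injective (trans (Fin.toℕ-fromℕ< (ℕ.m%n<n u n))
                                             (ℕ.m<n⇒m%n≡m (ℕ.s<s (Fin.toℕ<n i))))

        pass≤η : pass u ≤ η
        pass≤η = +-cancelʳ-≤ (Pr-reject τ (comparison u)) (begin
          pass u + Pr-reject τ (comparison u)  ≤⟨ Pr-total≤1 τ (comparison u) ⟩
          1#                                 ≤⟨ x-y≤z⇒x≤z+y (rejects ε η (endpoint M t (u mod n)) (endpoint M t zero) 0<ε 0<η η<1
            (subst (λ v → ε < ‖ prob (endpoint M t v) ⊖ prob (endpoint M t zero) ‖₁) (sym u-mod-n≡i) far)) ⟩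
          Pr-reject τ (comparison u) + η       ≡⟨ +-comm _ η ⟩
          η + Pr-reject τ (comparison u)       ∎)
          where open ≤-Reasoning

        η<δ : Fin n′ → η < δ
        η<δ = η<δ′ n′
          where
          -- Stated for every m, so that the element of Fin m can exclude m = 0.
          η<δ′ : ∀ m → Fin m → δ / fromℕ (suc m) < δ
          η<δ′ (suc m) _ = subst (δ / fromℕ (2 ℕ.+ m) <_) (shares (suc m) δ) (x<x+y _ 0<[1+m]share)
            where
            share : Carrier
            share = δ / fromℕ (2 ℕ.+ m)
            0<[1+m]share : 0# < fromℕ (suc m) * share
            0<[1+m]share = subst (0# <_) (sym (fromℕ-suc-* m share))
              (<-≤-trans (share-positive (2 ℕ.+ m) 0<δ)
                (x≤x+y share (*-nonNegative (fromℕ-nonNegative m) (proj₁ (share-positive (2 ℕ.+ m) 0<δ)))))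

theorem27 : ∀ {c ℓ} (K : OrderedField c ℓ) → let open OrderedField K in let open Model K in
    (f : Carrier → Carrier) (T : ℕ → Carrier → Carrier → ℕ)
    (tester : Program L1TesterTy) → IsL1Tester f T tester →
    Σ[ test ∈ Program MixingTestTy ]
    Σ[ time ∈ (ℕ → ℕ → Carrier → Carrier → ℕ) ]
    (∃[ C ] ∀ n t ε δ .{{_ : NonZero n}} .{{_ : NonZero t}} →
    0# < ε → 0# < δ → δ < 1# →
    time n t ε δ ℕ.≤ C ℕ.* (n ℕ.* t ℕ.* T n ε (δ / fromℕ n)))
    × (∀ {n} .{{_ : NonZero n}} (M : MarkovChain n) t ε δ →
    0# < ε → 0# < δ → δ < 1# →
    HaltsWithin (time n t ε δ) (runMixingTest test t ε δ M)
    × (Mixing (f ε / fromℕ 2) t M →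
    1# - δ < Pr-accept (time n t ε δ) (runMixingTest test t ε δ M))
    × (¬ Mixing ε t M →
    Pr-accept (time n t ε δ) (runMixingTest test t ε δ M) < δ))
theorem27 K f T tester isTester =
  mixingTest tester ,
  time ,
  (137 , linear) ,
  λ { {suc n′} M t ε δ 0<ε 0<δ δ<1 →
    let halting , Pr≡ = runs isTester M t 0<ε 0<δ δ<1 in
    halting ,
    (λ mixing → subst (1# - δ <_) (sym Pr≡) (acceptance isTester M t 0<ε 0<δ δ<1 mixing)) ,
    (λ ¬mixing → subst (_< δ) (sym Pr≡) (rejection isTester M t 0<ε 0<δ δ<1 ¬mixing)) }
  where
  open OrderedField K
  open Model K
  open OrderedFieldProperties K
  open Correctness K
  time : ℕ → ℕ → Carrier → Carrier → ℕ
  time n t ε δ = testCost n t (T n ε (δ / fromℕ n))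

  linear : ∀ n t ε δ .{{_ : NonZero n}} .{{_ : NonZero t}} → 0# < ε → 0# < δ → δ < 1# →
           time n t ε δ ℕ.≤ 137 ℕ.* (n ℕ.* t ℕ.* T n ε (δ / fromℕ n))
  linear n t ε δ 0<ε 0<δ δ<1 = testCost-bound n t (T n ε (δ / fromℕ n))
    where instance
      τ≢0 : NonZero (T n ε (δ / fromℕ n))
      τ≢0 = T-nonZero isTester n 0<ε (share-positive n 0<δ) (≤-<-trans (share-≤ n 0<δ) δ<1)
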